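{- For an integer $n \geq 3$, let $K_n^{1/2}$ denote the graph obtained from the complete graph $K_n$ by subdividing every edge exactly once. Then $$\frac{1}{2}\left\lfloor \log\log(n-1)\right\rfloor \leq \pi(K_n^{1/2}) \leq (1+o(1))\log\log(n-1),$$ where $o(1)$ denotes a quantity tending to $0$ as $n \to \infty$.
   Context: All graphs are finite, simple and undirected; $\log$ denotes the logarithm to base $2$. Subdividing an edge $\{x,y\}$ once means replacing it by a path $x, w, y$ through a new vertex $w$ of degree $2$. A permutation of a finite set $U$ is a bijection $\sigma: U \to [|U|]$. For disjoint $A,B \subseteq U$, write $A \prec_\sigma B$ if $\sigma(a)<\sigma(b)$ for all $a \in A$, $b \in B$; $\sigma$ separates $A$ and $B$ if $A \prec_\sigma B$ or $B \prec_\sigma A$. A family $\mathcal{F}$ of permutations of $V(G)$ is pairwise suitable for $G$ if for every two disjoint edges $e,f$ of $G$ (viewed as 2-element vertex sets) some $\sigma \in \mathcal{F}$ separates $e$ and $f$. The separation dimension $\pi(G)$ is the minimum cardinality of a family of permutations of $V(G)$ that is pairwise suitable for $G$. -}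

module Defs where

open import Data.Nat using (ℕ; _+_; _<_)
open import Data.Nat.Logarithm using (⌊log₂_⌋)
open import Data.Fin as Fin using (Fin)
open import Data.Sum using (_⊎_; inj₁; inj₂)
open import Data.Product using (Σ; _×_; _,_; proj₁; proj₂; ∃-syntax)
open import Data.List using (List; length)
open import Data.List.Membership.Propositional using (_∈_)
open import Data.Empty using (⊥)
open import Function.Bundles using (Bijection)
open import Relation.Binary.PropositionalEquality using (_≡_; _≢_; setoid)

record Graph : Set₁ where
  field
    V      : Set
    Adj    : V → V → Set
    adj-sym    : ∀ {x y} → Adj x y → Adj y x
    adj-irrefl : ∀ {x} → Adj x x → ⊥

module _ (G : Graph) where
  open Graph G

  -- A permutation of V(G): a bijection V(G) → [m] (here Fin m).  Since it is
  -- a bijection, m is necessarily |V(G)|.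
  Permutation : Set
  Permutation = Σ ℕ (λ m → Bijection (setoid V) (setoid (Fin m)))

  Separates : Permutation → V → V → V → V → Set
  Separates σ a b c d =
      (s a Fin.< s c × s a Fin.< s d × s b Fin.< s c × s b Fin.< s d)
    ⊎ (s c Fin.< s a × s c Fin.< s b × s d Fin.< s a × s d Fin.< s b)
    where s = Bijection.to (proj₂ σ)

  PairwiseSuitable : List Permutation → Set
  PairwiseSuitable F =
    ∀ a b c d → Adj a b → Adj c d →
      a ≢ c → a ≢ d → b ≢ c → b ≢ d →
      ∃[ σ ] (σ ∈ F × Separates σ a b c d)

  IsSepDim : ℕ → Set
  IsSepDim k =
      (∃[ F ] (PairwiseSuitable F × length F ≡ k))
    × (∀ F → PairwiseSuitable F → k Data.Nat.≤ length F)

-- Vertices of K_n^{1/2}: the n original vertices, and one subdivision vertex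
-- for each pair {i,j} with i < j.
SubdV : ℕ → Set
SubdV n = Fin n ⊎ Σ (Fin n × Fin n) (λ p → proj₁ p Fin.< proj₂ p)

data SubdAdj (n : ℕ) : SubdV n → SubdV n → Set where
  lr : ∀ {i j k} {p : j Fin.< k} → (i ≡ j ⊎ i ≡ k) → SubdAdj n (inj₁ i) (inj₂ ((j , k) , p))
  rl : ∀ {i j k} {p : j Fin.< k} → (i ≡ j ⊎ i ≡ k) → SubdAdj n (inj₂ ((j , k) , p)) (inj₁ i)

subd-sym : ∀ {n} {x y : SubdV n} → SubdAdj n x y → SubdAdj n y x
subd-sym (lr e) = rl e
subd-sym (rl e) = lr e

subd-irrefl : ∀ {n} {x : SubdV n} → SubdAdj n x x → ⊥
subd-irrefl ()

KnHalf : ℕ → Graph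
KnHalf n = record
  { V = SubdV n ; Adj = SubdAdj n
  ; adj-sym = subd-sym ; adj-irrefl = subd-irrefl }

-- ⌊log log m⌋ (base 2) for m ≥ 2, computed as ⌊log₂ ⌊log₂ m⌋⌋ (equal to
-- ⌊log₂ log₂ m⌋ since ⌊log₂ x⌋ = ⌊log₂ ⌊x⌋⌋ for real x ≥ 1).
⌊loglog⌋ : ℕ → ℕ
⌊loglog⌋ m = ⌊log₂ ⌊log₂ m ⌋ ⌋

{-# OPTIONS --safe #-}

-- Lower bound.  By iterated Erdős–Szekeres, k permutations have more than 2^2^k + 1 common
-- monotone original vertices v₀, v₁, …; reverse permutations so that all of them increase.
-- Colour a < b by the set of permutations with v_b before the subdivision vertex of
-- {v_a, v_(b+1)}.  If (a, b) and (b, d) have the same colour, then no permutation separates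
-- the end at v_(b+1) of the edge {v_a, v_(b+1)} from the end at v_b of {v_b, v_(d+1)}; and
-- such a < b < d exist because a shift graph on t points needs log t colours.
--
-- Upper bound.  Keep the original vertices in their natural order and insert the
-- subdivision vertex of each pair P next to one of its two ends: this separates any two
-- half-edges whose subdivision vertices are placed at their own ends.  "Always the lower"
-- and "always the upper" end leave the half-edges at the lower end of P and the upper end
-- of Q.  Let the level of a pair be the height at which its ends' branches meet in the
-- binary tree on the vertices.  Placing by the bits of a Berger code of the level handles
-- pairs of different levels, with loglog n + O(logloglog n) permutations.  Pairs of the
-- same level either lie in disjoint intervals or have the same tree midpoint, and then
-- placing at the midpoint, in an order and its reverse, separates them.
module Submission where

open import Defs
open import Data.Nat using (ℕ; _+_; _*_; _∸_; _≤_; _≥_; suc)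
open import Data.Product using (_×_; ∃-syntax)
open import Data.Bool using (Bool; true; false; not; if_then_else_)
open import Data.Fin as Fin using (Fin; toℕ; inject₁; inject≤; combine; funToFin; finToFun)
import Data.Fin.Properties as Fin
open import Data.List
  using (List; []; _∷_; _++_; map; concatMap; cartesianProduct; length; lookup; allFin; foldr)
open import Data.List.Membership.Propositional using (_∈_; find; lose)
open import Data.List.Membership.Propositional.Properties
  using (∈-lookup; ∈-++⁺ˡ; ∈-++⁺ʳ; ∈-map⁺; ∈-concatMap⁺; ∈-cartesianProduct⁺; ∈-allFin)
open import Data.List.Properties using (length-map; length-++; length-tabulate)
open import Data.List.Relation.Binary.Sublist.Propositional
  using (_⊆_; []; _∷_; _∷ʳ_; ⊆-refl; ⊆-trans; from∈; minimum)
open import Data.List.Relation.Binary.Sublist.Propositional.Properties using (All-resp-⊆)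
open import Data.List.Relation.Unary.All as All using (All; []; _∷_)
open import Data.List.Relation.Unary.All.Properties using (¬Any⇒All¬)
open import Data.List.Relation.Unary.AllPairs using (AllPairs; []; _∷_)
open import Data.List.Relation.Unary.AllPairs.Properties using (tabulate⁺-<)
open import Data.List.Relation.Unary.Any as Any using (Any; here; there; any?)
open import Data.List.Relation.Unary.Any.Properties using (lookup-index; ++⁺ˡ; ++⁺ʳ; map⁺)
open import Data.Nat
  using (zero; _^_; _<_; z≤n; s≤s; z<s; s<s; s≤s⁻¹; ⌊_/2⌋; _<?_; _≟_)
open import Data.Nat.Logarithm
  using (⌊log₂_⌋; ⌊log₂⌋-mono-≤; ⌊log₂[2^n]⌋≡n; ⌊log₂⌊n/2⌋⌋≡⌊log₂n⌋∸1)
open import Data.Nat.Properties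
open import Data.Nat.Solver using (module +-*-Solver)
open import Data.Product using (Σ; ∃₂; _,_; proj₁; proj₂)
open import Data.Sum as Sum using (_⊎_; inj₁; inj₂)
open import Data.Sum.Properties using (inj₁-injective; inj₂-injective)
open import Function using (_∘_; const)
open import Function.Bundles using (Bijection)
open import Relation.Binary.Definitions using (Decidable; Transitive; tri<; tri≈; tri>)
open import Relation.Binary.PropositionalEquality
open import Relation.Nullary using (¬_; Dec; yes; no; contradiction; _×-dec_)

private variable A B : Set

-- Monotone sublists by the Erdős-Szekeres argument.

AllPairs-resp-⊆ : {R : A → A → Set} {xs ys : List A} → xs ⊆ ys → AllPairs R ys → AllPairs R xs
AllPairs-resp-⊆ [] [] = []
AllPairs-resp-⊆ (y ∷ʳ s) (_ ∷ ps) = AllPairs-resp-⊆ s ps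
AllPairs-resp-⊆ (refl ∷ s) (p ∷ ps) = All-resp-⊆ s p ∷ AllPairs-resp-⊆ s ps

AllPairs-lookup : {R : A → A → Set} {xs : List A} → AllPairs R xs →
  ∀ {i j} → i Fin.< j → R (lookup xs i) (lookup xs j)
AllPairs-lookup (p ∷ ps) {Fin.zero} {Fin.suc j} _ = All.lookup p (∈-lookup j)
AllPairs-lookup (p ∷ ps) {Fin.suc i} {Fin.suc j} (s≤s i<j) = AllPairs-lookup ps i<j

module _ {R : A → A → Set} (R? : Decidable R) (R-trans : Transitive R) where

  -- In use, `zs` is `ys` followed by a successor of its last element. The final clause lets the
  -- induction put elements back in front.
  Prolongs : List A → List A → Set
  Prolongs ns xs = ∀ {ys} → ys ⊆ ns → AllPairs R ys → 0 < length ys →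
    ∃[ zs ] zs ⊆ xs × AllPairs R zs × length zs ≡ suc (length ys)
          × (∀ {w} → All (R w) ys → All (R w) zs)

  Prolongs-∷ʳ : ∀ {ns xs} x → Prolongs ns xs → Prolongs ns (x ∷ xs)
  Prolongs-∷ʳ x ext s c l = let zs , t , rest = ext s c l in zs , x ∷ʳ t , rest

  Prolongs-∷ : ∀ {ns xs} x → Any (R x) xs → Prolongs ns xs → Prolongs (x ∷ ns) (x ∷ xs)
  Prolongs-∷ x _ ext (.x ∷ʳ s) c l = Prolongs-∷ʳ x ext s c l
  Prolongs-∷ x a ext {.x ∷ []} (refl ∷ s) c l with find a
  ... | z , z∈ , r = x ∷ z ∷ [] , refl ∷ from∈ z∈ , (r ∷ []) ∷ [] ∷ [] , refl
      , λ { (w ∷ []) → w ∷ R-trans w r ∷ [] }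
  Prolongs-∷ x a ext {.x ∷ y ∷ ys} (refl ∷ s) (p ∷ c) l with ext s c z<s
  ... | zs , t , d , len , up = x ∷ zs , refl ∷ t , up p ∷ d , cong suc len
      , λ { (w ∷ ws) → w ∷ up ws }

  -- The elements without an R-successor further along in xs go to ms, the others to ns.
  split : ∀ xs → ∃₂ λ ms ns → ms ⊆ xs × ns ⊆ xs × length ms + length ns ≡ length xs
    × AllPairs (λ x y → ¬ R x y) ms × Prolongs ns xs
  split [] = [] , [] , [] , [] , refl , [] , λ { [] _ () }
  split (x ∷ xs) with split xs | any? (R? x) xs
  ... | ms , ns , m⊆ , n⊆ , len , anti , ext | yes a =
    ms , x ∷ ns , x ∷ʳ m⊆ , refl ∷ n⊆ , trans (+-suc _ _) (cong suc len) , anti , Prolongs-∷ x a ext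
  ... | ms , ns , m⊆ , n⊆ , len , anti , ext | no ¬a =
    x ∷ ms , ns , refl ∷ m⊆ , x ∷ʳ n⊆ , cong suc len , All-resp-⊆ m⊆ (¬Any⇒All¬ _ ¬a) ∷ anti , Prolongs-∷ʳ x ext

  -- Induction on `p`. If `ms` has at most `q` elements, more than `p * q` remain in `ns`, and a
  -- chain of more than `p` of those gains an element in `xs`.
  erdős–szekeres : ∀ p q xs → p * q < length xs → ∃[ ys ] ys ⊆ xs ×
    ((AllPairs R ys × p < length ys) ⊎ (AllPairs (λ x y → ¬ R x y) ys × q < length ys))
  erdős–szekeres zero q (x ∷ xs) _ = x ∷ [] , refl ∷ minimum xs , inj₁ ([] ∷ [] , z<s)
  erdős–szekeres (suc p) q xs pq< with split xs
  ... | ms , ns , m⊆ , n⊆ , len , anti , ext with q <? length ms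
  ...   | yes q< = ms , m⊆ , inj₂ (anti , q<)
  ...   | no q≮ with erdős–szekeres p q ns
                       (+-cancelˡ-< q _ _ (<-≤-trans pq<
                         (≤-trans (≤-reflexive (sym len)) (+-monoˡ-≤ (length ns) (≮⇒≥ q≮)))))
  ...     | ys , s , inj₂ c = ys , ⊆-trans s n⊆ , inj₂ c
  ...     | ys , s , inj₁ (c , p<) with ext s c (≤-<-trans z≤n p<)
  ...       | zs , t , d , eq , _ = zs , t , inj₁ (d , subst (suc p <_) (sym eq) (s<s p<))

-- Each relation costs a square root: both parameters of `erdős–szekeres` are the root of the
-- current bound, so either outcome leaves enough elements for the remaining relations.
multi-erdős–szekeres : (R : B → A → A → Set) → (∀ b → Decidable (R b)) → (∀ b → Transitive (R b)) →
  ∀ bs p xs → p ^ (2 ^ length bs) < length xs → ∃[ ys ] ys ⊆ xs × p < length ys ×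
    All (λ b → AllPairs (R b) ys ⊎ AllPairs (λ x y → ¬ R b x y) ys) bs
multi-erdős–szekeres R R? R-trans [] p xs l = xs , ⊆-refl , subst (_< _) (*-identityʳ p) l , []
multi-erdős–szekeres R R? R-trans (b ∷ bs) p xs l
  with erdős–szekeres (R? b) (R-trans b) (p ^ 2^k) (p ^ 2^k) xs (subst (_< _) square l)
  where
  2^k = 2 ^ length bs
  square : p ^ (2^k + (2^k + 0)) ≡ p ^ 2^k * p ^ 2^k
  square = trans (cong (λ m → p ^ (2^k + m)) (+-identityʳ 2^k)) (^-distribˡ-+-* p 2^k 2^k)
... | ys , s , h with multi-erdős–szekeres R R? R-trans bs p ys (longer h)
  where
  longer : {P Q : Set} {m n : ℕ} → (P × m < n) ⊎ (Q × m < n) → m < n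
  longer (inj₁ (_ , l)) = l
  longer (inj₂ (_ , l)) = l
...   | zs , t , l′ , hs = zs , ⊆-trans t s , l′ , restrict h ∷ hs
  where
  restrict : {P Q : Set} → (AllPairs (R b) ys × P) ⊎ (AllPairs (λ x y → ¬ R b x y) ys × Q) →
    AllPairs (R b) zs ⊎ AllPairs (λ x y → ¬ R b x y) zs
  restrict (inj₁ (c , _)) = inj₁ (AllPairs-resp-⊆ t c)
  restrict (inj₂ (c , _)) = inj₂ (AllPairs-resp-⊆ t c)

-- Colourings of the shift graph.

bit : {P : Set} → Dec P → Fin 2
bit (yes _) = Fin.suc Fin.zero
bit (no _) = Fin.zero

bit-transport : {P Q : Set} (d : Dec P) (e : Dec Q) → bit d ≡ bit e → P → Q
bit-transport d (yes q) _ _ = q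
bit-transport (yes _) (no _) () _
bit-transport (no ¬p) (no _) _ p = contradiction p ¬p

funToFin-cancel : ∀ {m n} {f g : Fin m → Fin n} → funToFin f ≡ funToFin g → ∀ i → f i ≡ g i
funToFin-cancel {f = f} {g} eq i =
  trans (sym (Fin.finToFun-funToFin f i)) (trans (cong (λ w → finToFun w i) eq) (Fin.finToFun-funToFin g i))

-- The set T a of colours used from a to later points determines a: c a b lies in T a,
-- and in T b only if the conclusion holds.
shift-colouring : ∀ {t q} → 2 ^ q < t → (c : Fin t → Fin t → Fin q) →
  ∃[ a ] ∃[ b ] ∃[ d ] a Fin.< b × b Fin.< d × c a b ≡ c b d
shift-colouring {t} {q} q<t c with Fin.pigeonhole q<t (λ a → funToFin (λ γ → bit (T? a γ)))
  where
  T? : ∀ a γ → Dec (∃[ b ] a Fin.< b × c a b ≡ γ)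
  T? a γ = Fin.any? (λ b → (a Fin.<? b) ×-dec (c a b Fin.≟ γ))
... | a , b , a<b , eq with bit-transport _ _ (funToFin-cancel eq (c a b)) (b , a<b , refl)
... | d , b<d , eq′ = a , b , d , a<b , b<d , sym eq′

-- Small families fail to be pairwise suitable.

module _ {n : ℕ} where
  private
    G = KnHalf n
    V = SubdV n

  _<[_]_ : Fin n → Permutation G → Fin n → Set
  i <[ σ ] j = Bijection.to (proj₂ σ) (inj₁ i) Fin.< Bijection.to (proj₂ σ) (inj₁ j)

  MonotoneOn : ∀ {m} → (Fin m → Fin n) → Permutation G → Set
  MonotoneOn v σ = (∀ {i j} → i Fin.< j → v i <[ σ ] v j) ⊎ (∀ {i j} → i Fin.< j → v j <[ σ ] v i)

  module Oriented (F : List (Permutation G)) {m : ℕ} (v : Fin (suc m) → Fin n)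
    (v-mono : ∀ {i j} → i Fin.< j → v i Fin.< v j)
    (v-monotone : All (MonotoneOn v) F) where

    private
      k = length F
      s : ∀ r → V → Fin _
      s r = Bijection.to (proj₂ (lookup F r))
      dir : ∀ r → MonotoneOn v (lookup F r)
      dir r = All.lookup v-monotone (∈-lookup r)

    -- Separation is invariant under reversal, so comparing backwards where `v` decreases makes `v`
    -- increase in every order without building reversed permutations.
    _≺[_]_ : V → Fin k → V → Set
    x ≺[ r ] y with dir r
    ... | inj₁ _ = s r x Fin.< s r y
    ... | inj₂ _ = s r y Fin.< s r x

    ≺? : ∀ r x y → Dec (x ≺[ r ] y)
    ≺? r x y with dir r
    ... | inj₁ _ = s r x Fin.<? s r y
    ... | inj₂ _ = s r y Fin.<? s r x

    ≺-trans : ∀ r {x y z} → x ≺[ r ] y → y ≺[ r ] z → x ≺[ r ] z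
    ≺-trans r p q with dir r
    ... | inj₁ _ = <-trans p q
    ... | inj₂ _ = <-trans q p

    ≺-irrefl : ∀ r {x} → ¬ (x ≺[ r ] x)
    ≺-irrefl r p with dir r
    ... | inj₁ _ = n≮n _ p
    ... | inj₂ _ = n≮n _ p

    v-≺ : ∀ r {i j} → i Fin.< j → inj₁ (v i) ≺[ r ] inj₁ (v j)
    v-≺ r i<j with dir r
    ... | inj₁ f = f i<j
    ... | inj₂ f = f i<j

    separates-oriented : ∀ r {a b c d} → Separates G (lookup F r) a b c d → c ≺[ r ] a →
      c ≺[ r ] b × d ≺[ r ] a
    separates-oriented r sep c≺a with dir r | sep
    ... | inj₁ _ | inj₁ (a<c , _) = contradiction c≺a (<-asym a<c)
    ... | inj₁ _ | inj₂ (_ , cb , da , _) = cb , da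
    ... | inj₂ _ | inj₁ (_ , ad , bc , _) = bc , ad
    ... | inj₂ _ | inj₂ (c<a , _) = contradiction c≺a (<-asym c<a)

    -- The subdivision vertex of {v_a, v_(b+1)}, with a junk value when a > b.
    sub : Fin m → Fin m → V
    sub a b with inject₁ a Fin.<? Fin.suc b
    ... | yes p = inj₂ ((v (inject₁ a) , v (Fin.suc b)) , v-mono p)
    ... | no _ = inj₁ (v (inject₁ a))

    sub-edge : ∀ {a b} → a Fin.< b →
      ∃[ p ] sub a b ≡ inj₂ ((v (inject₁ a) , v (Fin.suc b)) , p)
    sub-edge {a} {b} a<b with inject₁ a Fin.<? Fin.suc b
    ... | yes p = v-mono p , refl
    ... | no ¬p = contradiction (subst (_< suc (toℕ b)) (sym (Fin.toℕ-inject₁ a)) (m<n⇒m<1+n a<b)) ¬p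

    colour : Fin m → Fin m → Fin (2 ^ k)
    colour a b = funToFin (λ r → bit (≺? r (inj₁ (v (inject₁ b))) (sub a b)))

    module _ (suit : PairwiseSuitable G F) {a b d : Fin m} (a<b : a Fin.< b) (b<d : b Fin.< d) where
      private
        va vb vb⁺ vd vd⁺ : Fin n
        va = v (inject₁ a)
        vb = v (inject₁ b)
        vb⁺ = v (Fin.suc b)
        vd = v (inject₁ d)
        vd⁺ = v (Fin.suc d)

        b<b⁺ : inject₁ b Fin.< Fin.suc b
        b<b⁺ = s≤s (≤-reflexive (Fin.toℕ-inject₁ b))

        v-≢ : ∀ {i j} → i Fin.< j → v i ≢ v j
        v-≢ i<j e = <⇒≢ (v-mono i<j) (cong toℕ e)

        va≢vb : va ≢ vb
        va≢vb = v-≢ (subst₂ _<_ (sym (Fin.toℕ-inject₁ a)) (sym (Fin.toℕ-inject₁ b)) a<b)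

        vb⁺≼vd : ∀ r {x} → x ≺[ r ] inj₁ vb⁺ → x ≺[ r ] inj₁ vd
        vb⁺≼vd r {x} x≺ with m≤n⇒m<n∨m≡n (subst (suc (toℕ b) ≤_) (sym (Fin.toℕ-inject₁ d)) b<d)
        ... | inj₁ lt = ≺-trans r x≺ (v-≺ r {Fin.suc b} {inject₁ d} lt)
        ... | inj₂ e = subst (λ i → x ≺[ r ] inj₁ (v i)) (Fin.toℕ-injective {i = Fin.suc b} {inject₁ d} e) x≺

        -- The edge from `vb⁺` to `sub a b` and the edge from `vb` to `sub b d` are disjoint. Since
        -- `vb` precedes `vb⁺` in every order, the order separating them puts the second edge first;
        -- and `vb⁺` is `vd` or precedes it.
        some-order : ∃[ r ] inj₁ vb ≺[ r ] sub a b × sub b d ≺[ r ] inj₁ vd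
        some-order =
          let p , e = sub-edge a<b
              p′ , e′ = sub-edge b<d
              σ , σ∈ , sep = suit (inj₁ vb⁺) (inj₂ ((va , vb⁺) , p)) (inj₁ vb) (inj₂ ((vb , vd⁺) , p′))
                (lr (inj₂ refl)) (lr (inj₁ refl))
                (λ q → v-≢ b<b⁺ (sym (inj₁-injective q))) (λ ()) (λ ())
                (λ q → va≢vb (cong (proj₁ ∘ proj₁) (inj₂-injective q)))
              r = Any.index σ∈
              vb≺ , ≺vb⁺ = separates-oriented r
                (subst (λ τ → Separates G τ (inj₁ vb⁺) (inj₂ ((va , vb⁺) , p)) (inj₁ vb) (inj₂ ((vb , vd⁺) , p′)))
                       (lookup-index σ∈) sep)
                (v-≺ r b<b⁺)
          in r , subst (inj₁ vb ≺[ r ]_) (sym e) vb≺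
               , vb⁺≼vd r (subst (_≺[ r ] inj₁ vb⁺) (sym e′) ≺vb⁺)

      -- The order from `some-order` sets its bit in `colour a b`. Were that bit set in `colour b d`
      -- too, `vd` would precede `sub b d`, which precedes `vd`.
      colour-≢ : colour a b ≢ colour b d
      colour-≢ eq =
        let r , vb≺ , ≺vd = some-order
            vd≺ = bit-transport (≺? r (inj₁ vb) (sub a b)) (≺? r (inj₁ vd) (sub b d)) (funToFin-cancel eq r) vb≺
        in ≺-irrefl r (≺-trans r vd≺ ≺vd)

    unsuitable : 2 ^ (2 ^ k) < m → ¬ PairwiseSuitable G F
    unsuitable m> suit =
      let a , b , d , a<b , b<d , eq = shift-colouring m> colour
      in colour-≢ suit a<b b<d eq

  -- Erdős-Szekeres leaves more than `x * x` vertices, and `x + 2` of them are used. Rounding up to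
  -- a power of two makes the threshold exactly 2^(2^(2k+1)) for k permutations.
  long⇒unsuitable : ∀ F → (2 ^ (2 ^ suc (length F))) ^ (2 ^ length F) < n → ¬ PairwiseSuitable G F
  long⇒unsuitable F n> suit =
    let ys , ys⊆ , long , mono = multi-erdős–szekeres (λ σ i j → i <[ σ ] j) (λ σ _ _ → _ Fin.<? _) (λ σ → <-trans) F
          (2 ^ (2 ^ suc (length F))) (allFin n) (<-≤-trans n> (≤-reflexive (sym (length-tabulate {n = n} _))))
    in contra ys⊆ long mono suit
    where
    x = 2 ^ (2 ^ length F)
    x≥2 : 2 ≤ x
    x≥2 = ^-monoʳ-≤ 2 (m^n>0 2 (length F))
    contra : ∀ {ys} → ys ⊆ allFin n → 2 ^ (2 ^ suc (length F)) < length ys →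
      All (λ σ → AllPairs _<[ σ ]_ ys ⊎ AllPairs (λ i j → ¬ i <[ σ ] j) ys) F → ¬ PairwiseSuitable G F
    contra {ys} ys⊆ long mono = Oriented.unsuitable F v v-mono (All.map (λ {σ} → monotone σ) mono) ≤-refl
      where
      -- The shift colouring takes `x + 1` points, and the index b + 1 in `sub` one more.
      enough : suc (suc x) ≤ length ys
      enough = ≤-trans (s≤s (begin
        1 + x       ≤⟨ +-monoˡ-≤ x (<⇒≤ x≥2) ⟩
        x + x       ≡⟨ cong (x +_) (+-identityʳ x) ⟨
        2 * x       ≤⟨ *-monoˡ-≤ x x≥2 ⟩
        x * x       ≡⟨ ^-distribˡ-+-* 2 (2 ^ length F) _ ⟨
        2 ^ (2 ^ length F + 2 ^ length F)        ≡⟨ cong (λ m → 2 ^ (2 ^ length F + m)) (+-identityʳ (2 ^ length F)) ⟨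
        2 ^ (2 ^ suc (length F)) ∎)) long
        where open ≤-Reasoning
      v : Fin (suc (suc x)) → Fin n
      v i = lookup ys (inject≤ i enough)
      at : {S : Fin n → Fin n → Set} → AllPairs S ys → ∀ {i j} → i Fin.< j → S (v i) (v j)
      at ap {i} {j} i<j = AllPairs-lookup ap
        (subst₂ _<_ (sym (Fin.toℕ-inject≤ i enough)) (sym (Fin.toℕ-inject≤ j enough)) i<j)
      v-mono : ∀ {i j} → i Fin.< j → v i Fin.< v j
      v-mono = at (AllPairs-resp-⊆ ys⊆ (tabulate⁺-< (λ i<j → i<j)))
      monotone : ∀ σ → AllPairs _<[ σ ]_ ys ⊎ AllPairs (λ i j → ¬ i <[ σ ] j) ys → MonotoneOn v σ
      monotone σ (inj₁ ap) = inj₁ (at ap)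
      -- Not increasing becomes strictly decreasing because the permutation is injective and `v` has
      -- distinct entries.
      monotone σ (inj₂ ap) = inj₂ λ i<j → ≤∧≢⇒< (≮⇒≥ (at ap i<j))
        (λ e → <⇒≢ (v-mono i<j) (sym (cong toℕ (inj₁-injective (Bijection.injective (proj₂ σ) (Fin.toℕ-injective e))))))

-- Floors of logarithms and the numerical lower bound.

2^≤⇒≤⌊log₂⌋ : ∀ e {n} → 2 ^ e ≤ n → e ≤ ⌊log₂ n ⌋
2^≤⇒≤⌊log₂⌋ e {n} le = subst (_≤ ⌊log₂ n ⌋) (⌊log₂[2^n]⌋≡n e) (⌊log₂⌋-mono-≤ le)

n<2^[1+⌊log₂n⌋] : ∀ n → n < 2 ^ suc ⌊log₂ n ⌋
n<2^[1+⌊log₂n⌋] n = ≰⇒> λ le → n≮n _ (2^≤⇒≤⌊log₂⌋ (suc ⌊log₂ n ⌋) le)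

2*⌊n/2⌋≤n : ∀ n → 2 * ⌊ n /2⌋ ≤ n
2*⌊n/2⌋≤n zero = z≤n
2*⌊n/2⌋≤n (suc zero) = z≤n
2*⌊n/2⌋≤n (suc (suc n)) = subst (_≤ suc (suc n)) (sym (*-suc 2 ⌊ n /2⌋)) (s≤s (s≤s (2*⌊n/2⌋≤n n)))

≤⌊log₂⌋⇒2^≤ : ∀ e n → 0 < n → e ≤ ⌊log₂ n ⌋ → 2 ^ e ≤ n
≤⌊log₂⌋⇒2^≤ zero n n>0 _ = n>0
≤⌊log₂⌋⇒2^≤ (suc e) 1 _ ()
≤⌊log₂⌋⇒2^≤ (suc e) n@(suc (suc n′)) _ le = ≤-trans
  (*-monoʳ-≤ 2 (≤⌊log₂⌋⇒2^≤ e ⌊ n /2⌋ z<s (subst (e ≤_) (sym (⌊log₂⌊n/2⌋⌋≡⌊log₂n⌋∸1 n)) (∸-monoˡ-≤ 1 le))))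
  (2*⌊n/2⌋≤n n)

-- If the left side were at least 2k + 1, then n - 1 would reach the threshold of `long⇒unsuitable`.
-- From n ≥ 3 the inner logarithm is positive, so the outer one can be inverted.
loglog-lower : ∀ n → n ≥ 3 → ∀ k → IsSepDim (KnHalf n) k → ⌊loglog⌋ (n ∸ 1) ≤ 2 * k
loglog-lower n@(suc m) (s≤s m≥2) k ((F , suit , refl) , _) = ≮⇒≥ λ lt → long⇒unsuitable F (s≤s (begin
  (2 ^ (2 ^ suc k)) ^ (2 ^ k)   ≡⟨ ^-*-assoc 2 (2 ^ suc k) (2 ^ k) ⟩
  2 ^ (2 ^ suc k * 2 ^ k)       ≡⟨ cong (2 ^_) (^-distribˡ-+-* 2 (suc k) k) ⟨
  2 ^ (2 ^ suc (k + k))         ≡⟨ cong (λ w → 2 ^ (2 ^ suc (k + w))) (+-identityʳ k) ⟨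
  2 ^ (2 ^ suc (2 * k))         ≤⟨ ≤⌊log₂⌋⇒2^≤ _ m (<⇒≤ m≥2)
                                     (≤⌊log₂⌋⇒2^≤ _ ⌊log₂ m ⌋ (⌊log₂⌋-mono-≤ m≥2) lt) ⟩
  m ∎)) suit
  where open ≤-Reasoning

-- Permutations from injective keys.

module Ranking {V : Set} (key : V → ℕ) (key-injective : ∀ u v → key u ≡ key v → u ≡ v)
  (xs : List V) (complete : ∀ v → v ∈ xs) where

  -- Equal keys mean equal elements, so a repeated element is dropped and `xs` may list vertices
  -- more than once.
  insert : V → List V → List V
  insert x [] = x ∷ []
  insert x (y ∷ ys) with <-cmp (key x) (key y)
  ... | tri< _ _ _ = x ∷ y ∷ ys
  ... | tri≈ _ _ _ = y ∷ ys
  ... | tri> _ _ _ = y ∷ insert x ys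

  insert-All : {P : V → Set} → ∀ {x ys} → P x → All P ys → All P (insert x ys)
  insert-All p [] = p ∷ []
  insert-All {x = x} {y ∷ ys} p (q ∷ qs) with <-cmp (key x) (key y)
  ... | tri< _ _ _ = p ∷ q ∷ qs
  ... | tri≈ _ _ _ = q ∷ qs
  ... | tri> _ _ _ = q ∷ insert-All p qs

  _<ₖ_ : V → V → Set
  u <ₖ v = key u < key v

  insert-AllPairs : ∀ x {ys} → AllPairs _<ₖ_ ys → AllPairs _<ₖ_ (insert x ys)
  insert-AllPairs x [] = [] ∷ []
  insert-AllPairs x {y ∷ ys} (p ∷ ps) with <-cmp (key x) (key y)
  ... | tri< lt _ _ = (lt ∷ All.map (<-trans lt) p) ∷ p ∷ ps
  ... | tri≈ _ _ _ = p ∷ ps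
  ... | tri> _ _ gt = insert-All gt p ∷ insert-AllPairs x ps

  insert-here : ∀ x ys → x ∈ insert x ys
  insert-here x [] = here refl
  insert-here x (y ∷ ys) with <-cmp (key x) (key y)
  ... | tri< _ _ _ = here refl
  ... | tri≈ _ eq _ = here (key-injective x y eq)
  ... | tri> _ _ _ = there (insert-here x ys)

  insert-there : ∀ x {z ys} → z ∈ ys → z ∈ insert x ys
  insert-there x {ys = y ∷ ys} z∈ with <-cmp (key x) (key y)
  insert-there x z∈ | tri< _ _ _ = there z∈
  insert-there x z∈ | tri≈ _ _ _ = z∈
  insert-there x (here e) | tri> _ _ _ = here e
  insert-there x (there z∈) | tri> _ _ _ = there (insert-there x z∈)

  sorted : List V
  sorted = foldr insert [] xs

  sorted-AllPairs : AllPairs _<ₖ_ sorted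
  sorted-AllPairs = go xs
    where
    go : ∀ zs → AllPairs _<ₖ_ (foldr insert [] zs)
    go [] = []
    go (z ∷ zs) = insert-AllPairs z (go zs)

  ∈-sorted : ∀ v → v ∈ sorted
  ∈-sorted v = go xs (complete v)
    where
    go : ∀ zs → v ∈ zs → v ∈ foldr insert [] zs
    go (z ∷ zs) (here refl) = insert-here z (foldr insert [] zs)
    go (z ∷ zs) (there v∈) = insert-there z (go zs v∈)

  rank : V → Fin (length sorted)
  rank v = Any.index (∈-sorted v)

  lookup-rank : ∀ v → v ≡ lookup sorted (rank v)
  lookup-rank v = lookup-index (∈-sorted v)

  rank-reflects-< : ∀ u v → rank u Fin.< rank v → key u < key v
  rank-reflects-< u v lt = subst₂ _<ₖ_ (sym (lookup-rank u)) (sym (lookup-rank v))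
    (AllPairs-lookup sorted-AllPairs lt)

  rank-injective : ∀ {u v} → rank u ≡ rank v → u ≡ v
  rank-injective {u} {v} e = trans (lookup-rank u) (trans (cong (lookup sorted) e) (sym (lookup-rank v)))

  rank-mono : ∀ u v → key u < key v → rank u Fin.< rank v
  rank-mono u v lt with Fin.<-cmp (rank u) (rank v)
  ... | tri< r< _ _ = r<
  ... | tri≈ _ e _ = contradiction (cong key (rank-injective e)) (<⇒≢ lt)
  ... | tri> _ _ r> = contradiction lt (<-asym (rank-reflects-< v u r>))

  rank-lookup : ∀ i → rank (lookup sorted i) ≡ i
  rank-lookup i with Fin.<-cmp (rank (lookup sorted i)) i
  ... | tri≈ _ e _ = e
  ... | tri< r< _ _ = contradiction (cong key (sym (lookup-rank (lookup sorted i))))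
                        (<⇒≢ (AllPairs-lookup sorted-AllPairs r<))
  ... | tri> _ _ r> = contradiction (cong key (lookup-rank (lookup sorted i)))
                        (<⇒≢ (AllPairs-lookup sorted-AllPairs r>))

  rank-bijection : Bijection (setoid V) (setoid (Fin (length sorted)))
  rank-bijection = record
    { to = rank
    ; cong = cong rank
    ; bijective = rank-injective , λ i → lookup sorted i , λ { refl → rank-lookup i }
    }

-- Orders on the subdivided complete graph from two-digit keys.

lex-< : ∀ {m a a′ b} b′ → a < a′ → b < m → a * m + b < a′ * m + b′
lex-< {m} {a} {a′} {b} b′ a<a′ b<m = begin-strict
  a * m + b  <⟨ +-monoʳ-< (a * m) b<m ⟩
  a * m + m  ≡⟨ +-comm (a * m) m ⟩
  suc a * m  ≤⟨ *-monoˡ-≤ m a<a′ ⟩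
  a′ * m     ≤⟨ m≤m+n (a′ * m) b′ ⟩
  a′ * m + b′ ∎
  where open ≤-Reasoning

lex-injective : ∀ {m a a′ b b′} → b < m → b′ < m → a * m + b ≡ a′ * m + b′ → a ≡ a′ × b ≡ b′
lex-injective {m} {a} {a′} {b} {b′} b< b′< e with <-cmp a a′
... | tri< lt _ _ = contradiction e (<⇒≢ (lex-< b′ lt b<))
... | tri≈ _ refl _ = refl , +-cancelˡ-≡ (a * m) b b′ e
... | tri> _ _ gt = contradiction (sym e) (<⇒≢ (lex-< b gt b′<))

Pair : ℕ → Set
Pair n = Σ (Fin n × Fin n) (λ p → proj₁ p Fin.< proj₂ p)

module _ {n : ℕ} where

  lo hi : Pair n → Fin n
  lo P = proj₁ (proj₁ P)
  hi P = proj₂ (proj₁ P)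

  Pair-≡ : ∀ {P Q : Pair n} → proj₁ P ≡ proj₁ Q → P ≡ Q
  Pair-≡ {p , l} {.p , l′} refl = cong (p ,_) (<-irrelevant l l′)

  pairAt : Fin n × Fin n → List (SubdV n)
  pairAt (j , k) with j Fin.<? k
  ... | yes l = inj₂ ((j , k) , l) ∷ []
  ... | no _ = []

  ∈-pairAt : ∀ P → inj₂ P ∈ pairAt (proj₁ P)
  ∈-pairAt ((j , k) , l) with j Fin.<? k
  ... | yes l′ = here (cong inj₂ (Pair-≡ refl))
  ... | no ¬l = contradiction l ¬l

  vertices : List (SubdV n)
  vertices = map inj₁ (allFin n) ++ concatMap pairAt (cartesianProduct (allFin n) (allFin n))

  ∈-vertices : ∀ v → v ∈ vertices
  ∈-vertices (inj₁ i) = ∈-++⁺ˡ (∈-map⁺ inj₁ (∈-allFin i))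
  ∈-vertices (inj₂ P@((j , k) , _)) = ∈-++⁺ʳ (map inj₁ (allFin n))
    (∈-concatMap⁺ pairAt (lose (∈-cartesianProduct⁺ (∈-allFin j) (∈-allFin k)) (∈-pairAt P)))

  record Tie : Set where
    field
      τ : Pair n → ℕ
      τ≤ : ∀ P → τ P ≤ n * n
      τ-injective : ∀ {P Q} → τ P ≡ τ Q → P ≡ Q
  open Tie

  -- The subdivision vertex of P is put just before the vertex pos P, and those put
  -- before the same vertex are sorted by the tie-break.
  module _ (pos : Pair n → ℕ) (t : Tie) where
    private
      -- Low digits up to `n * n` are tie-breaks; the top digit goes to the original vertex, which
      -- therefore follows everything at its position.
      m = suc (suc (n * n))

    key : SubdV n → ℕ
    key (inj₁ i) = toℕ i * m + suc (n * n)
    key (inj₂ P) = pos P * m + τ t P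

    private
      τ<m : ∀ P → τ t P < m
      τ<m P = s≤s (m≤n⇒m≤1+n (τ≤ t P))

    key-injective : ∀ u v → key u ≡ key v → u ≡ v
    key-injective (inj₁ i) (inj₁ j) e = cong inj₁ (Fin.toℕ-injective (proj₁ (lex-injective ≤-refl ≤-refl e)))
    key-injective (inj₁ i) (inj₂ P) e = contradiction (sym (proj₂ (lex-injective {m} {toℕ i} {pos P} ≤-refl (τ<m P) e))) (<⇒≢ (s≤s (τ≤ t P)))
    key-injective (inj₂ P) (inj₁ j) e = contradiction (proj₂ (lex-injective {m} {pos P} {toℕ j} (τ<m P) ≤-refl e)) (<⇒≢ (s≤s (τ≤ t P)))
    key-injective (inj₂ P) (inj₂ Q) e = cong inj₂ (τ-injective t (proj₂ (lex-injective {m} {pos P} {pos Q} (τ<m P) (τ<m Q) e)))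

    open Ranking key key-injective vertices ∈-vertices

    arrangement : Permutation (KnHalf n)
    arrangement = length sorted , rank-bijection

    -- A subdivision vertex placed at position `z` still precedes `z`, so the bound on `pos P` is
    -- weak; for the same reason `pos Q` must exceed `x` strictly.
    arrangement-separates : ∀ {x P z Q} → x Fin.< z → pos P ≤ toℕ z → toℕ x < pos Q →
      (pos P < pos Q ⊎ (pos P ≡ pos Q × τ t P < τ t Q)) →
      Separates (KnHalf n) arrangement (inj₁ x) (inj₂ P) (inj₁ z) (inj₂ Q)
    arrangement-separates {x} {P} {z} {Q} x<z P≤z x<Q P<Q = inj₁
      ( rank-mono (inj₁ x) (inj₁ z) (lex-< _ x<z ≤-refl)
      , rank-mono (inj₁ x) (inj₂ Q) (lex-< _ x<Q ≤-refl)
      , rank-mono (inj₂ P) (inj₁ z) (+-mono-≤-< (*-monoˡ-≤ m P≤z) (s≤s (τ≤ t P)))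
      , rank-mono (inj₂ P) (inj₂ Q) (lt P<Q))
      where
      lt : (pos P < pos Q ⊎ (pos P ≡ pos Q × τ t P < τ t Q)) → key (inj₂ P) < key (inj₂ Q)
      lt (inj₁ p<q) = lex-< _ p<q (τ<m P)
      lt (inj₂ (p≡q , τ<)) = +-mono-≤-< (≤-reflexive (cong (_* m) p≡q)) τ<

  lexTie : Tie
  lexTie = record
    { τ = λ P → toℕ (combine (lo P) (hi P))
    ; τ≤ = λ P → <⇒≤ (Fin.toℕ<n (combine (lo P) (hi P)))
    ; τ-injective = λ {P} {Q} e →
        let e₁ , e₂ = Fin.combine-injective (lo P) (hi P) (lo Q) (hi Q) (Fin.toℕ-injective e)
        in Pair-≡ (cong₂ _,_ e₁ e₂)
    }

  reverse : Tie → Tie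
  reverse t = record
    { τ = λ P → n * n ∸ τ t P
    ; τ≤ = λ P → m∸n≤m (n * n) (τ t P)
    ; τ-injective = λ {P} {Q} e → τ-injective t (∸-cancelˡ-≡ (τ≤ t P) (τ≤ t Q) e)
    }

  end : Bool → Pair n → Fin n
  end true = hi
  end false = lo

  choice : (Pair n → Bool) → Permutation (KnHalf n)
  choice χ = arrangement (λ P → toℕ (end (χ P) P)) lexTie

  choice-separates : ∀ χ {x P z Q} → end (χ P) P ≡ x → end (χ Q) Q ≡ z → x ≢ z →
    Separates (KnHalf n) (choice χ) (inj₁ x) (inj₂ P) (inj₁ z) (inj₂ Q)
  choice-separates χ {P = P} {Q = Q} refl refl x≢z with Fin.<-cmp (end (χ P) P) (end (χ Q) Q)
  ... | tri< lt _ _ = arrangement-separates _ lexTie lt (<⇒≤ lt) lt (inj₁ lt)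
  ... | tri≈ _ e _ = contradiction e x≢z
  ... | tri> _ _ gt = Sum.swap (arrangement-separates _ lexTie gt (<⇒≤ gt) gt (inj₁ gt))

  -- The edges of the subdivision are the flags of the complete graph, a pair with one of its ends.
  -- This form fixes which endpoint is the original vertex.
  FlagSuitable : List (Permutation (KnHalf n)) → Set
  FlagSuitable F = ∀ b P c Q → end b P ≢ end c Q → P ≢ Q →
    ∃[ σ ] σ ∈ F × Separates (KnHalf n) σ (inj₁ (end b P)) (inj₂ P) (inj₁ (end c Q)) (inj₂ Q)

  swapˡ : ∀ {σ : Permutation (KnHalf n)} {a b c d} → Separates (KnHalf n) σ a b c d → Separates (KnHalf n) σ b a c d
  swapˡ (inj₁ (ac , ad , bc , bd)) = inj₁ (bc , bd , ac , ad)
  swapˡ (inj₂ (ca , cb , da , db)) = inj₂ (cb , ca , db , da)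

  swapʳ : ∀ {σ : Permutation (KnHalf n)} {a b c d} → Separates (KnHalf n) σ a b c d → Separates (KnHalf n) σ a b d c
  swapʳ (inj₁ (ac , ad , bc , bd)) = inj₁ (ad , ac , bd , bc)
  swapʳ (inj₂ (ca , cb , da , db)) = inj₂ (da , db , ca , cb)

  incidence : ∀ {i j k : Fin n} → i ≡ j ⊎ i ≡ k → (l : j Fin.< k) → ∃[ b ] end b ((j , k) , l) ≡ i
  incidence (inj₁ e) l = false , sym e
  incidence (inj₂ e) l = true , sym e

  flagSuitable⇒pairwiseSuitable : ∀ {F} → FlagSuitable F → PairwiseSuitable (KnHalf n) F
  flagSuitable⇒pairwiseSuitable {F} suit = go
    where
    flags : ∀ {x P z Q} → (∃[ b ] end b P ≡ x) → (∃[ c ] end c Q ≡ z) → inj₁ {B = Pair n} x ≢ inj₁ z → inj₂ {A = Fin n} P ≢ inj₂ Q →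
      ∃[ σ ] σ ∈ F × Separates (KnHalf n) σ (inj₁ x) (inj₂ P) (inj₁ z) (inj₂ Q)
    flags {P = P} {Q = Q} (b , refl) (c , refl) x≢z P≢Q = suit b P c Q (x≢z ∘ cong inj₁) (P≢Q ∘ cong inj₂)

    go : PairwiseSuitable (KnHalf n) F
    go _ _ _ _ (lr {p = l} i) (lr {p = l′} i′) ac ad bc bd = flags (incidence i l) (incidence i′ l′) ac bd
    go _ _ _ _ (lr {p = l} i) (rl {p = l′} i′) ac ad bc bd =
      let σ , σ∈ , s = flags (incidence i l) (incidence i′ l′) ad bc in σ , σ∈ , swapʳ {σ} s
    go _ _ _ _ (rl {p = l} i) (lr {p = l′} i′) ac ad bc bd =
      let σ , σ∈ , s = flags (incidence i l) (incidence i′ l′) bc ad in σ , σ∈ , swapˡ {σ} s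
    go _ _ _ _ (rl {p = l} i) (rl {p = l′} i′) ac ad bc bd =
      let σ , σ∈ , s = flags (incidence i l) (incidence i′ l′) bd ac in σ , σ∈ , swapˡ {σ} (swapʳ {σ} s)

-- Levels and midpoints in the binary tree.

n≤1+2*⌊n/2⌋ : ∀ n → n ≤ suc (2 * ⌊ n /2⌋)
n≤1+2*⌊n/2⌋ zero = z≤n
n≤1+2*⌊n/2⌋ (suc zero) = s≤s z≤n
n≤1+2*⌊n/2⌋ (suc (suc n)) = subst (λ w → suc (suc n) ≤ suc w) (sym (*-suc 2 ⌊ n /2⌋)) (s≤s (s≤s (n≤1+2*⌊n/2⌋ n)))

⌊/2⌋-cancel-< : ∀ {m n} → ⌊ m /2⌋ < ⌊ n /2⌋ → m < n
⌊/2⌋-cancel-< lt = ≰⇒> λ n≤m → <⇒≱ lt (⌊n/2⌋-mono n≤m)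

⌊/2⌋-<2^ : ∀ {f k} → k < 2 ^ suc f → ⌊ k /2⌋ < 2 ^ f
⌊/2⌋-<2^ {f} {k} lt = *-cancelˡ-< 2 ⌊ k /2⌋ (2 ^ f) (≤-<-trans (2*⌊n/2⌋≤n k) lt)

⌊/2⌋-mono-<-≢ : ∀ {i k} → i < k → ⌊ i /2⌋ ≢ ⌊ k /2⌋ → ⌊ i /2⌋ < ⌊ k /2⌋
⌊/2⌋-mono-<-≢ i<k h≢ = ≤∧≢⇒< (⌊n/2⌋-mono (<⇒≤ i<k)) h≢

siblings-odd : ∀ {i k} → i < k → ⌊ i /2⌋ ≡ ⌊ k /2⌋ → k ≡ suc (2 * ⌊ k /2⌋)
siblings-odd {i} {k} i<k e = ≤-antisym (n≤1+2*⌊n/2⌋ k)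
  (≤-trans (s≤s (subst (λ w → 2 * w ≤ i) e (2*⌊n/2⌋≤n i))) i<k)

-- For i < k < 2 ^ f, level f i k is the height at which the branches of i and k in the
-- binary tree with leaves 0, …, 2 ^ f - 1 meet, and midpoint f i k is the leftmost leaf
-- of the right subtree there.
level : ℕ → ℕ → ℕ → ℕ
level zero i k = 0
level (suc f) i k with ⌊ i /2⌋ ≟ ⌊ k /2⌋
... | yes _ = 0
... | no _ = suc (level f ⌊ i /2⌋ ⌊ k /2⌋)

midpoint : ℕ → ℕ → ℕ → ℕ
midpoint zero i k = k
midpoint (suc f) i k with ⌊ i /2⌋ ≟ ⌊ k /2⌋
... | yes _ = k
... | no _ = 2 * midpoint f ⌊ i /2⌋ ⌊ k /2⌋

level-< : ∀ f {i k} → i < k → k < 2 ^ f → level f i k < f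
level-< zero i<k (s≤s z≤n) = contradiction i<k n≮0
level-< (suc f) {i} {k} i<k k< with ⌊ i /2⌋ ≟ ⌊ k /2⌋
... | yes _ = z<s
... | no h≢ = s<s (level-< f (⌊/2⌋-mono-<-≢ i<k h≢) (⌊/2⌋-<2^ {f} k<))

-- These are the strict and the weak bound that `arrangement-separates` asks for when subdivision
-- vertices sit at midpoints.
midpoint-bounds : ∀ f {i k} → i < k → i < midpoint f i k × midpoint f i k ≤ k
midpoint-bounds zero i<k = i<k , ≤-refl
midpoint-bounds (suc f) {i} {k} i<k with ⌊ i /2⌋ ≟ ⌊ k /2⌋
... | yes _ = i<k , ≤-refl
... | no h≢ with midpoint-bounds f (⌊/2⌋-mono-<-≢ i<k h≢)
...   | i/2<mid , mid≤k/2 =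
  (begin-strict
    i                            ≤⟨ n≤1+2*⌊n/2⌋ i ⟩
    suc (2 * ⌊ i /2⌋)            <⟨ n<1+n _ ⟩
    2 + 2 * ⌊ i /2⌋              ≡⟨ *-suc 2 ⌊ i /2⌋ ⟨
    2 * suc ⌊ i /2⌋              ≤⟨ *-monoʳ-≤ 2 i/2<mid ⟩
    2 * midpoint f ⌊ i /2⌋ ⌊ k /2⌋ ∎)
  , ≤-trans (*-monoʳ-≤ 2 mid≤k/2) (2*⌊n/2⌋≤n k)
  where open ≤-Reasoning

-- Halve until both pairs are siblings, which happens simultaneously. Equal parents then give equal
-- midpoints, and distinct parents give disjoint intervals; halving reflects strict inequality.
same-level : ∀ f {i k l j} → i < k → k < 2 ^ f → l < j → level f i k ≡ level f l j →
  midpoint f i k ≡ midpoint f l j ⊎ (k < l ⊎ j < i)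
same-level zero i<k (s≤s z≤n) _ _ = contradiction i<k n≮0
same-level (suc f) {i} {k} {l} {j} i<k k< l<j e with ⌊ i /2⌋ ≟ ⌊ k /2⌋ | ⌊ l /2⌋ ≟ ⌊ j /2⌋
... | yes p | yes q with <-cmp ⌊ k /2⌋ ⌊ j /2⌋
...   | tri< lt _ _ = inj₂ (inj₁ (⌊/2⌋-cancel-< (subst (⌊ k /2⌋ <_) (sym q) lt)))
...   | tri> _ _ gt = inj₂ (inj₂ (⌊/2⌋-cancel-< (subst (⌊ j /2⌋ <_) (sym p) gt)))
...   | tri≈ _ r _ = inj₁ (trans (siblings-odd i<k p) (trans (cong (λ w → suc (2 * w)) r) (sym (siblings-odd l<j q))))
same-level (suc f) i<k k< l<j e | no p | no q
  with same-level f (⌊/2⌋-mono-<-≢ i<k p) (⌊/2⌋-<2^ {f} k<) (⌊/2⌋-mono-<-≢ l<j q) (suc-injective e)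
... | inj₁ r = inj₁ (cong (2 *_) r)
... | inj₂ (inj₁ r) = inj₂ (inj₁ (⌊/2⌋-cancel-< r))
... | inj₂ (inj₂ r) = inj₂ (inj₂ (⌊/2⌋-cancel-< r))
same-level (suc f) i<k k< l<j () | yes _ | no _
same-level (suc f) i<k k< l<j () | no _ | yes _

-- Berger codes.

odd : ℕ → Bool
odd zero = false
odd (suc n) = not (odd n)

bits : ℕ → List (ℕ → Bool)
bits zero = []
bits (suc b) = odd ∷ map (_∘ ⌊_/2⌋) (bits b)

zeros : ℕ → ℕ → ℕ
zeros zero x = 0
zeros (suc b) x = (if odd x then 0 else 1) + zeros b ⌊ x /2⌋

length-bits : ∀ b → length (bits b) ≡ b
length-bits zero = refl
length-bits (suc b) = cong suc (trans (length-map (_∘ ⌊_/2⌋) (bits b)) (length-bits b))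

zeros-≤ : ∀ b x → zeros b x ≤ b
zeros-≤ zero x = z≤n
zeros-≤ (suc b) x with odd x
... | true = m≤n⇒m≤1+n (zeros-≤ b ⌊ x /2⌋)
... | false = s≤s (zeros-≤ b ⌊ x /2⌋)

-- A bit `false` selects the lower end and `true` the upper, so a bit rising from the level of P to
-- that of Q places P at `lo P` and Q at `hi Q`.
Rises : ℕ → ℕ → (ℕ → Bool) → Set
Rises x y g = g x ≡ false × g y ≡ true

odd-decomposition : ∀ n → n ≡ (if odd n then 1 else 0) + 2 * ⌊ n /2⌋
odd-decomposition zero = refl
odd-decomposition (suc zero) = refl
odd-decomposition (suc (suc n)) with odd n | odd-decomposition n
... | true | e = cong suc (trans (cong suc e) (sym (*-suc 2 ⌊ n /2⌋)))
... | false | e = trans (cong (suc ∘ suc) e) (sym (*-suc 2 ⌊ n /2⌋))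

-- The highest bit where the two numbers differ is 0 in the smaller one.
rising-bit-< : ∀ d {x y} → x < y → y < 2 ^ d → Any (Rises x y) (bits d)
rising-bit-< zero x<y (s≤s z≤n) = contradiction x<y n≮0
rising-bit-< (suc d) {x} {y} x<y y< with ⌊ x /2⌋ ≟ ⌊ y /2⌋
... | no h≢ = there (map⁺ (rising-bit-< d (⌊/2⌋-mono-<-≢ x<y h≢) (⌊/2⌋-<2^ {d} y<)))
... | yes e with odd x in ox | odd y in oy | odd-decomposition x | odd-decomposition y
...   | false | true | _ | _ = here (ox , oy)
...   | false | false | px | py = contradiction (trans px (trans (cong (2 *_) e) (sym py))) (<⇒≢ x<y)
...   | true | true | px | py = contradiction (trans px (trans (cong (suc ∘ (2 *_)) e) (sym py))) (<⇒≢ x<y)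
...   | true | false | px | py = contradiction x<y (≤⇒≯ (subst₂ _≤_ (sym (trans py (cong (2 *_) (sym e)))) (sym px) (n≤1+n _)))

-- If no bit rises, the ones of `y` form a proper subset of those of `x`.
rising-bit-or-zeros-< : ∀ b {x y} → x ≢ y → x < 2 ^ b → y < 2 ^ b → Any (Rises x y) (bits b) ⊎ zeros b x < zeros b y
rising-bit-or-zeros-< zero x≢y (s≤s z≤n) (s≤s z≤n) = contradiction refl x≢y
rising-bit-or-zeros-< (suc b) {x} {y} x≢y x< y< with ⌊ x /2⌋ ≟ ⌊ y /2⌋
... | no h≢ with rising-bit-or-zeros-< b h≢ (⌊/2⌋-<2^ {b} x<) (⌊/2⌋-<2^ {b} y<)
...   | inj₁ a = inj₁ (there (map⁺ a))
...   | inj₂ z< with odd x in ox | odd y in oy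
...     | false | true = inj₁ (here (ox , oy))
...     | false | false = inj₂ (s<s z<)
...     | true | true = inj₂ z<
...     | true | false = inj₂ (m<n⇒m<1+n z<)
rising-bit-or-zeros-< (suc b) {x} {y} x≢y x< y< | yes e with odd x in ox | odd y in oy | odd-decomposition x | odd-decomposition y
... | false | true | _ | _ = inj₁ (here (ox , oy))
... | false | false | px | py = contradiction (trans px (trans (cong (2 *_) e) (sym py))) x≢y
... | true | true | px | py = contradiction (trans px (trans (cong (suc ∘ (2 *_)) e) (sym py))) x≢y
... | true | false | _ | _ = inj₂ (s≤s (≤-reflexive (cong (zeros b) e)))

-- The Berger code: appending the number of zero bits makes the code words pairwise
-- incomparable, since x ⊊ y bitwise forces zeros y < zeros x.
berger : ℕ → ℕ → List (ℕ → Bool)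
berger b d = bits b ++ map (_∘ zeros b) (bits d)

length-berger : ∀ b d → length (berger b d) ≡ b + d
length-berger b d = trans (length-++ (bits b))
  (cong₂ _+_ (length-bits b) (trans (length-map (_∘ zeros b) (bits d)) (length-bits d)))

berger-rises : ∀ b d → b < 2 ^ d → ∀ {x y} → x ≢ y → x < 2 ^ b → y < 2 ^ b → Any (Rises x y) (berger b d)
berger-rises b d b< {x} {y} x≢y x< y< with rising-bit-or-zeros-< b x≢y x< y<
... | inj₁ a = ++⁺ˡ a
... | inj₂ z< = ++⁺ʳ (bits b) (map⁺ (rising-bit-< d z< (≤-<-trans (zeros-≤ b y) b<)))

-- The separating family: tree height `f`, levels of `b` bits, zero counts of `d` bits.

module _ {n f b d : ℕ} (n≤2^f : n ≤ 2 ^ f) (f≤2^b : f ≤ 2 ^ b) (b<2^d : b < 2 ^ d) where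

  lvl mid : Pair n → ℕ
  lvl P = level f (toℕ (lo P)) (toℕ (hi P))
  mid P = midpoint f (toℕ (lo P)) (toℕ (hi P))

  byCode : (ℕ → Bool) → Permutation (KnHalf n)
  byCode g = choice (g ∘ lvl)

  family : List (Permutation (KnHalf n))
  family = choice (const false) ∷ choice (const true)
         ∷ arrangement mid lexTie ∷ arrangement mid (reverse lexTie)
         ∷ map byCode (berger b d)

  length-family : length family ≡ 4 + (b + d)
  length-family = cong (4 +_) (trans (length-map byCode (berger b d)) (length-berger b d))

  hi< : ∀ (P : Pair n) → toℕ (hi P) < 2 ^ f
  hi< P = <-≤-trans (Fin.toℕ<n (hi P)) n≤2^f

  lvl< : ∀ P → lvl P < 2 ^ b
  lvl< P = <-≤-trans (level-< f (proj₂ P) (hi< P)) f≤2^b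

  Separated : Fin n → Pair n → Fin n → Pair n → Set
  Separated x P z Q = ∃[ σ ] σ ∈ family × Separates (KnHalf n) σ (inj₁ x) (inj₂ P) (inj₁ z) (inj₂ Q)

  mixed : ∀ P Q → lo P ≢ hi Q → P ≢ Q → Separated (lo P) P (hi Q) Q
  mixed P Q x≢z P≢Q with lvl P ≟ lvl Q
  ... | no h≢ with find (berger-rises b d b<2^d h≢ (lvl< P) (lvl< Q))
  ...   | g , g∈ , gP , gQ = byCode g , there (there (there (there (∈-map⁺ byCode g∈))))
        , choice-separates (g ∘ lvl) (cong (λ c → end c P) gP) (cong (λ c → end c Q) gQ) x≢z
  mixed P Q x≢z P≢Q | yes e with same-level f (proj₂ P) (hi< P) (proj₂ Q) e
  ... | inj₂ (inj₁ k<l) = choice (const false) , here refl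
      , arrangement-separates _ lexTie (<-trans i<l (proj₂ Q)) (<⇒≤ (<-trans i<l (proj₂ Q))) i<l (inj₁ i<l)
      where i<l = <-trans (proj₂ P) k<l
  ... | inj₂ (inj₂ j<i) = choice (const false) , here refl
      , Sum.swap (arrangement-separates _ lexTie j<i (<⇒≤ l<i) j<i (inj₁ l<i))
      where l<i = <-trans (proj₂ Q) j<i
  -- With both subdivision vertices at the common midpoint, P has to come before Q there; one of the
  -- two tie-breaks achieves this.
  ... | inj₁ m≡ with <-cmp (Tie.τ lexTie P) (Tie.τ lexTie Q)
  ...   | tri≈ _ τ≡ _ = contradiction (Tie.τ-injective lexTie τ≡) P≢Q
  ...   | tri< τ< _ _ = arrangement mid lexTie , there (there (here refl))
        , arrangement-separates mid lexTie (<-≤-trans i<m m≤j) m≤j (subst (_ <_) m≡ i<m) (inj₂ (m≡ , τ<))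
        where
        i<m = proj₁ (midpoint-bounds f (proj₂ P))
        m≤j = subst (_≤ toℕ (hi Q)) (sym m≡) (proj₂ (midpoint-bounds f (proj₂ Q)))
  ...   | tri> _ _ τ> = arrangement mid (reverse lexTie) , there (there (there (here refl)))
        , arrangement-separates mid (reverse lexTie) (<-≤-trans i<m m≤j) m≤j (subst (_ <_) m≡ i<m)
            (inj₂ (m≡ , ∸-monoʳ-< τ> (Tie.τ≤ lexTie P)))
        where
        i<m = proj₁ (midpoint-bounds f (proj₂ P))
        m≤j = subst (_≤ toℕ (hi Q)) (sym m≡) (proj₂ (midpoint-bounds f (proj₂ Q)))

  family-suitable : PairwiseSuitable (KnHalf n) family
  family-suitable = flagSuitable⇒pairwiseSuitable suit
    where
    suit : FlagSuitable family
    suit false P false Q x≢z _ = choice (const false) , here refl , choice-separates (const false) refl refl x≢z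
    suit true P true Q x≢z _ = choice (const true) , there (here refl) , choice-separates (const true) refl refl x≢z
    suit false P true Q x≢z P≢Q = mixed P Q x≢z P≢Q
    suit true P false Q x≢z P≢Q =
      let σ , σ∈ , s = mixed Q P (x≢z ∘ sym) (P≢Q ∘ sym) in σ , σ∈ , Sum.swap s

-- Asymptotics of the family size.

n<2^n : ∀ n → n < 2 ^ n
n<2^n zero = z<s
n<2^n (suc n) = begin-strict
  suc n             ≡⟨ +-comm 1 n ⟩
  n + 1             <⟨ +-mono-<-≤ (n<2^n n) (m^n>0 2 n) ⟩
  2 ^ n + 2 ^ n     ≡⟨ cong (2 ^ n +_) (+-identityʳ (2 ^ n)) ⟨
  2 ^ suc n         ∎
  where open ≤-Reasoning

-- At the least `x` the left side is below 14 * 4^c and the right is 64 * 4^c. Each further step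
-- adds `c` on the left, less than the 2^x added on the right.
linear<2^ : ∀ c x → 6 + 2 * c ≤ x → c * (6 + x) < 2 ^ x
linear<2^ c x le = subst (λ y → c * (6 + y) < 2 ^ y) (m+[n∸m]≡n le) (go (x ∸ (6 + 2 * c)))
  where
  open ≤-Reasoning
  u = 2 ^ c
  base : c * (6 + (6 + 2 * c)) < 2 ^ (6 + 2 * c)
  base = begin-strict
    c * (12 + 2 * c)      <⟨ *-monoˡ-< (12 + 2 * c) (n<2^n c) ⟩
    u * (12 + 2 * c)      ≤⟨ *-monoʳ-≤ u (+-mono-≤ (*-monoʳ-≤ 12 (m^n>0 2 c)) (*-monoʳ-≤ 2 (<⇒≤ (n<2^n c)))) ⟩
    u * (12 * u + 2 * u)  ≡⟨ solve 1 (λ u → u :* (con 12 :* u :+ con 2 :* u) := con 14 :* (u :* u)) refl u ⟩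
    14 * (u * u)          ≤⟨ *-monoˡ-≤ (u * u) (m≤m+n 14 50) ⟩
    64 * (u * u)          ≡⟨ cong (64 *_) (^-distribˡ-+-* 2 c c) ⟨
    64 * 2 ^ (c + c)      ≡⟨ cong (λ w → 64 * 2 ^ (c + w)) (+-identityʳ c) ⟨
    2 ^ 6 * 2 ^ (2 * c)   ≡⟨ ^-distribˡ-+-* 2 6 (2 * c) ⟨
    2 ^ (6 + 2 * c)       ∎
    where open +-*-Solver
  go : ∀ d → c * (6 + (6 + 2 * c + d)) < 2 ^ (6 + 2 * c + d)
  go zero = subst (λ y → c * (6 + y) < 2 ^ y) (sym (+-identityʳ (6 + 2 * c))) base
  go (suc d) = subst (λ y → c * (6 + y) < 2 ^ y) (sym (+-suc (6 + 2 * c) d)) (begin-strict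
    c * (7 + y)            ≡⟨ *-suc c (6 + y) ⟩
    c + c * (6 + y)        <⟨ +-mono-≤-< (≤-trans (m≤m*n c (6 + y)) (<⇒≤ (go d))) (go d) ⟩
    2 ^ y + 2 ^ y          ≡⟨ cong (2 ^ y +_) (+-identityʳ (2 ^ y)) ⟨
    2 ^ suc y              ∎)
    where y = 6 + 2 * c + d

log-sublinear : ∀ c l → 2 ^ (6 + 2 * c) ≤ l → c * (6 + ⌊log₂ suc l ⌋) ≤ l
log-sublinear c l le = s≤s⁻¹ (<-≤-trans
  (linear<2^ c x (2^≤⇒≤⌊log₂⌋ (6 + 2 * c) (m≤n⇒m≤1+n le)))
  (≤⌊log₂⌋⇒2^≤ x (suc l) z<s ≤-refl))
  where x = ⌊log₂ suc l ⌋

-- The o(1) term in integers: for each `j`, eventually k is at most 1 + 1/(j+1) times the iterated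
-- logarithm.
loglog-upper : ∀ j → ∃[ N ] ∀ n → n ≥ N → n ≥ 3 → ∀ k → IsSepDim (KnHalf n) k →
  suc j * k ≤ (suc j + 1) * ⌊loglog⌋ (n ∸ 1)
-- Two exponentials cancel the logarithms; the third is the threshold of `log-sublinear`.
loglog-upper j = suc (2 ^ (2 ^ (2 ^ e))) , bound
  where
  e = 6 + 2 * suc j
  bound : ∀ n → n ≥ suc (2 ^ (2 ^ (2 ^ e))) → n ≥ 3 → ∀ k → IsSepDim (KnHalf n) k →
    suc j * k ≤ (suc j + 1) * ⌊loglog⌋ (n ∸ 1)
  bound (suc m) (s≤s m≥) _ k (_ , minimal) = begin
    suc j * k                          ≤⟨ *-monoʳ-≤ (suc j) k≤ ⟩
    suc j * (l + (6 + x))              ≡⟨ *-distribˡ-+ (suc j) l (6 + x) ⟩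
    suc j * l + suc j * (6 + x)        ≤⟨ +-monoʳ-≤ (suc j * l) (log-sublinear (suc j) l l≥) ⟩
    suc j * l + l                      ≡⟨ cong (suc j * l +_) (*-identityˡ l) ⟨
    suc j * l + 1 * l                  ≡⟨ *-distribʳ-+ l (suc j) 1 ⟨
    (suc j + 1) * l                    ∎
    where
    open ≤-Reasoning
    l = ⌊loglog⌋ m
    x = ⌊log₂ suc l ⌋
    l≥ : 2 ^ e ≤ l
    l≥ = 2^≤⇒≤⌊log₂⌋ (2 ^ e) (2^≤⇒≤⌊log₂⌋ (2 ^ (2 ^ e)) m≥)
    n≤ = n<2^[1+⌊log₂n⌋] m
    f≤ = n<2^[1+⌊log₂n⌋] ⌊log₂ m ⌋
    b< = n<2^[1+⌊log₂n⌋] (suc l)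
    k≤ : k ≤ l + (6 + x)
    k≤ = begin
      k                            ≤⟨ minimal (family n≤ f≤ b<) (family-suitable n≤ f≤ b<) ⟩
      length (family n≤ f≤ b<)     ≡⟨ length-family n≤ f≤ b< ⟩
      -- The 6 is the four fixed permutations plus one for rounding up each of the two bit lengths.
      4 + (suc l + suc x)          ≡⟨ solve 2 (λ l x → con 4 :+ (con 1 :+ l :+ (con 1 :+ x)) := l :+ (con 6 :+ x)) refl l x ⟩
      l + (6 + x)                  ∎
      where open +-*-Solver

theorem2 : (∀ (n : ℕ) → n ≥ 3 → ∀ (k : ℕ) → IsSepDim (KnHalf n) k →
    ⌊loglog⌋ (n ∸ 1) ≤ 2 * k)
    ×
    (∀ (j : ℕ) → ∃[ N ] ∀ (n : ℕ) → n ≥ N → n ≥ 3 → ∀ (k : ℕ) →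
    IsSepDim (KnHalf n) k →
    suc j * k ≤ (suc j + 1) * ⌊loglog⌋ (n ∸ 1))
theorem2 = loglog-lower , loglog-upper
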